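{- The reduction relation $\to_{\Lambda M}$ on the set of objects of the $\Lambda M$-calculus is confluent: if $o\to^*_{\Lambda M}o_1$ and $o\to^*_{\Lambda M}o_2$, then there is an object $o_3$ with $o_1\to^*_{\Lambda M}o_3$ and $o_2\to^*_{\Lambda M}o_3$.
   Context: **Syntax of $\Lambda M$.** Fix countably infinite sets of variables $x,y,\dots$ and names $\alpha,\beta,\dots$. Objects $o$ are terms, commands or stacks: terms $t,u,v ::= x \mid t\,u \mid \lambda x.t \mid \mu\alpha.c \mid t[x\backslash u]$ (explicit substitution); commands $c ::= [\alpha]t \mid c[\![\alpha\backslash^{\alpha'}s]\!]$ (explicit replacement, $\alpha\neq\alpha'$); stacks $s ::= \epsilon \mid t\cdot s$. $\lambda x$ binds $x$ in $t$; $\mu\alpha$ binds $\alpha$ in $c$; $t[x\backslash u]$ binds $x$ in $t$ (not in $u$); $c[\![\alpha\backslash^{\alpha'}s]\!]$ binds $\alpha$ in $c$ (not in $s$), and $\alpha'$ is a free name occurrence in it; $[\alpha]t$ contains a free occurrence of $\alpha$. $\mathrm{fv}(o),\mathrm{fn}(o)$ are the free variables and free names. Objects are taken modulo $\alpha$-conversion. Stack concatenation $s\cdot s'$ is associative with neutral element $\epsilon$; the stack $u\cdot\epsilon$ is also written $u$. For a term $u$ and a stack $s=t_1\cdots t_n$ ($n\ge 0$), $u::s$ is the term $u\,t_1\dots t_n$. A context $\mathtt O$ is an object with exactly one hole (standing for a term, $\Box$, or for a command, $\boxdot$); $\mathtt O[o]$ is $\mathtt O$ with the hole filled by $o$ (capture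 allowed). An object $o$ is *free for* $\mathtt O$ if no bound variable or name of $\mathtt O$ is free in $o$. **Meta-operations.** $o\{x\backslash u\}$ is capture-avoiding substitution. For $\alpha\notin \mathrm{fn}(s)$, the (capture-avoiding) replacement $o\{\alpha\backslash^{\alpha'}s\}$, abbreviated $o^\star$ in this paragraph, commutes with all constructors except: $([\alpha]t)^\star=[\alpha'](t^\star::s)$; $(c[\![\gamma\backslash^{\alpha}\epsilon]\!])^\star=c^\star[\![\gamma\backslash^{\beta}s]\!][\![\beta\backslash^{\alpha'}\epsilon]\!]$ if $s\ne\epsilon$, with $\beta$ fresh; $(c[\![\gamma\backslash^{\alpha}\epsilon]\!])^\star=c^\star[\![\gamma\backslash^{\alpha'}\epsilon]\!]$ if $s=\epsilon$; $(c[\![\gamma\backslash^{\alpha}s']\!])^\star=c^\star[\![\gamma\backslash^{\alpha'}s'^\star\cdot s]\!]$ if $s'\neq\epsilon$. (So $([\beta]t)^\star=[\beta]t^\star$ and $(c[\![\gamma\backslash^{\beta}s']\!])^\star=c^\star[\![\gamma\backslash^{\beta}s'^\star]\!]$ for $\beta\ne\alpha$, $\epsilon^\star=\epsilon$, etc.) **Reduction.** Substitution contexts: $\mathtt L::=\Box\mid \mathtt L[x\backslash t]$. $\to_{\Lambda M}$ is the closure under all contexts of the rules (B) $\mathtt L[\lambda x.t]\,u\mapsto \mathtt L[t[x\backslash u]]$, with $u$ free for $\mathtt L$; (S) $t[x\backslash u]\mapsto t\{x\backslash u\}$; (M) $\mathtt L[\mu\alpha.c]\,u\mapsto\mathtt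 L[\mu\alpha'.c[\![\alpha\backslash^{\alpha'}u]\!]]$, with $u$ free for $\mathtt L$ and $\alpha'$ fresh (not occurring in $c,u,\mathtt L$, and $\alpha'\ne\alpha$); (R) $c[\![\alpha\backslash^{\alpha'}s]\!]\mapsto c\{\alpha\backslash^{\alpha'}s\}$. $\to^*_{\Lambda M}$ is the reflexive-transitive closure. -}

-- The ΛM-calculus in well-scoped de Bruijn style: an object of type Obj κ n m
-- has its free variables in Fin n and its free names in Fin m.  Objects modulo
-- α-conversion are thus compared by _≡_, "fresh" means weakened into an
-- extended scope, and side conditions such as α ≠ α′ and α ∉ fn(s) are enforced
-- by scoping.

module Defs where

open import Data.Fin using (Fin; zero; suc; lift; punchOut)
open import Data.Fin.Properties using (_≟_)
open import Data.Nat using (ℕ; suc)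
open import Function using (id)
open import Relation.Nullary using (yes; no)

data Sort : Set where
  term command stack : Sort

infixl 9 _[∖_] _⟦∖_^_⟧
infixl 8 _∙_
infixr 7 _·_ _++_
infixl 7 _∷_
infixr 6 ƛ_ μ_ [_]_

data Obj : Sort → ℕ → ℕ → Set where
  var      : ∀ {n m} → Fin n → Obj term n m
  _∙_      : ∀ {n m} → Obj term n m → Obj term n m → Obj term n m
  ƛ_       : ∀ {n m} → Obj term (suc n) m → Obj term n m
  μ_       : ∀ {n m} → Obj command n (suc m) → Obj term n m
  _[∖_]    : ∀ {n m} → Obj term (suc n) m → Obj term n m → Obj term n m
  [_]_     : ∀ {n m} → Fin m → Obj term n m → Obj command n m
  -- c ⟦∖ α′ ^ s ⟧ binds name zero in c only.
  _⟦∖_^_⟧  : ∀ {n m} → Obj command n (suc m) → Fin m → Obj stack n m →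
             Obj command n m
  ε        : ∀ {n m} → Obj stack n m
  _·_      : ∀ {n m} → Obj term n m → Obj stack n m → Obj stack n m

Term Command Stack : ℕ → ℕ → Set
Term    = Obj term
Command = Obj command
Stack   = Obj stack

_++_ : ∀ {n m} → Stack n m → Stack n m → Stack n m
ε       ++ s′ = s′
(t · s) ++ s′ = t · (s ++ s′)

-- u ∷ t₁ · … · tₖ · ε  is the term  u t₁ … tₖ.
_∷_ : ∀ {n m} → Term n m → Stack n m → Term n m
u ∷ ε       = u
u ∷ (t · s) = (u ∙ t) ∷ s

rename : ∀ {κ n n′ m m′} → (Fin n → Fin n′) → (Fin m → Fin m′) →
         Obj κ n m → Obj κ n′ m′
rename ρ ν (var x)          = var (ρ x)
rename ρ ν (t ∙ u)          = rename ρ ν t ∙ rename ρ ν u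
rename ρ ν (ƛ t)            = ƛ rename (lift 1 ρ) ν t
rename ρ ν (μ c)            = μ rename ρ (lift 1 ν) c
rename ρ ν (t [∖ u ])       = rename (lift 1 ρ) ν t [∖ rename ρ ν u ]
rename ρ ν ([ α ] t)        = [ ν α ] rename ρ ν t
rename ρ ν (c ⟦∖ α′ ^ s ⟧)  = rename ρ (lift 1 ν) c ⟦∖ ν α′ ^ rename ρ ν s ⟧
rename ρ ν ε                = ε
rename ρ ν (t · s)          = rename ρ ν t · rename ρ ν s

wkVar : ∀ {κ n m} → Obj κ n m → Obj κ (suc n) m
wkVar = rename suc id

wkName : ∀ {κ n m} → Obj κ n m → Obj κ n (suc m)
wkName = rename id suc

-- Substitution and replacement eliminate an arbitrary variable x or name α from
-- the scope; punchOut re-indexes the remaining ones.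

infixl 9 _⟨_∖_⟩ _⟨_∖_^_⟩

_⟨_∖_⟩ : ∀ {κ n m} → Obj κ (suc n) m → Fin (suc n) → Term n m → Obj κ n m
(var y) ⟨ x ∖ u ⟩ with x ≟ y
... | yes _   = u
... | no  x≢y = var (punchOut x≢y)
(t ∙ v) ⟨ x ∖ u ⟩          = t ⟨ x ∖ u ⟩ ∙ v ⟨ x ∖ u ⟩
(ƛ t) ⟨ x ∖ u ⟩            = ƛ t ⟨ suc x ∖ wkVar u ⟩
(μ c) ⟨ x ∖ u ⟩            = μ c ⟨ x ∖ wkName u ⟩
(t [∖ v ]) ⟨ x ∖ u ⟩       = t ⟨ suc x ∖ wkVar u ⟩ [∖ v ⟨ x ∖ u ⟩ ]
([ α ] t) ⟨ x ∖ u ⟩        = [ α ] t ⟨ x ∖ u ⟩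
(c ⟦∖ α′ ^ s ⟧) ⟨ x ∖ u ⟩  = c ⟨ x ∖ wkName u ⟩ ⟦∖ α′ ^ s ⟨ x ∖ u ⟩ ⟧
ε ⟨ x ∖ u ⟩                = ε
(t · s) ⟨ x ∖ u ⟩          = t ⟨ x ∖ u ⟩ · s ⟨ x ∖ u ⟩

-- The replacement of α in c ⟦∖ α ^ s′ ⟧, given the results for c and s′; the
-- latter is empty iff s′ is.  In the second clause the fresh name is zero in the
-- scope of the outer replacement, and lift 1 suc inserts it beneath the name
-- bound by the inner one.
extend : ∀ {n m} → Command n (suc m) → Fin m → Stack n m → Stack n m → Command n m
extend c α′ ε           ε         = c ⟦∖ α′ ^ ε ⟧
extend c α′ ε           s@(_ · _) =
  rename id (lift 1 suc) c ⟦∖ zero ^ wkName s ⟧ ⟦∖ α′ ^ ε ⟧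
extend c α′ s′@(_ · _)  s         = c ⟦∖ α′ ^ s′ ++ s ⟧

_⟨_∖_^_⟩ : ∀ {κ n m} → Obj κ n (suc m) → Fin (suc m) → Fin m → Stack n m →
           Obj κ n m
(var x) ⟨ α ∖ α′ ^ s ⟩     = var x
(t ∙ u) ⟨ α ∖ α′ ^ s ⟩     = t ⟨ α ∖ α′ ^ s ⟩ ∙ u ⟨ α ∖ α′ ^ s ⟩
(ƛ t) ⟨ α ∖ α′ ^ s ⟩       = ƛ t ⟨ α ∖ α′ ^ wkVar s ⟩
(μ c) ⟨ α ∖ α′ ^ s ⟩       = μ c ⟨ suc α ∖ suc α′ ^ wkName s ⟩
(t [∖ u ]) ⟨ α ∖ α′ ^ s ⟩  = t ⟨ α ∖ α′ ^ wkVar s ⟩ [∖ u ⟨ α ∖ α′ ^ s ⟩ ]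
([ β ] t) ⟨ α ∖ α′ ^ s ⟩ with α ≟ β
... | yes _   = [ α′ ] (t ⟨ α ∖ α′ ^ s ⟩ ∷ s)
... | no  α≢β = [ punchOut α≢β ] t ⟨ α ∖ α′ ^ s ⟩
(c ⟦∖ β ^ s′ ⟧) ⟨ α ∖ α′ ^ s ⟩ with α ≟ β
... | yes _   = extend (c ⟨ suc α ∖ suc α′ ^ wkName s ⟩) α′ (s′ ⟨ α ∖ α′ ^ s ⟩) s
... | no  α≢β = c ⟨ suc α ∖ suc α′ ^ wkName s ⟩
                  ⟦∖ punchOut α≢β ^ s′ ⟨ α ∖ α′ ^ s ⟩ ⟧
ε ⟨ α ∖ α′ ^ s ⟩           = ε
(t · s′) ⟨ α ∖ α′ ^ s ⟩    = t ⟨ α ∖ α′ ^ s ⟩ · s′ ⟨ α ∖ α′ ^ s ⟩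

-- Ctx κ₀ n₀ m₀ κ n m: contexts of sort κ in scope n, m whose unique hole has
-- sort κ₀ and scope n₀, m₀.  Plugging does not rename, hence allows capture.
data Ctx : (κ₀ : Sort) (n₀ m₀ : ℕ) (κ : Sort) (n m : ℕ) → Set where
  □         : ∀ {n m} → Ctx term n m term n m
  ⊡         : ∀ {n m} → Ctx command n m command n m
  _∙ˡ_      : ∀ {κ₀ n₀ m₀ n m} →
              Ctx κ₀ n₀ m₀ term n m → Term n m → Ctx κ₀ n₀ m₀ term n m
  _∙ʳ_      : ∀ {κ₀ n₀ m₀ n m} →
              Term n m → Ctx κ₀ n₀ m₀ term n m → Ctx κ₀ n₀ m₀ term n m
  ƛ_        : ∀ {κ₀ n₀ m₀ n m} →
              Ctx κ₀ n₀ m₀ term (suc n) m → Ctx κ₀ n₀ m₀ term n m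
  μ_        : ∀ {κ₀ n₀ m₀ n m} →
              Ctx κ₀ n₀ m₀ command n (suc m) → Ctx κ₀ n₀ m₀ term n m
  _[∖_]ˡ    : ∀ {κ₀ n₀ m₀ n m} →
              Ctx κ₀ n₀ m₀ term (suc n) m → Term n m → Ctx κ₀ n₀ m₀ term n m
  _[∖_]ʳ    : ∀ {κ₀ n₀ m₀ n m} →
              Term (suc n) m → Ctx κ₀ n₀ m₀ term n m → Ctx κ₀ n₀ m₀ term n m
  [_]_      : ∀ {κ₀ n₀ m₀ n m} →
              Fin m → Ctx κ₀ n₀ m₀ term n m → Ctx κ₀ n₀ m₀ command n m
  _⟦∖_^_⟧ˡ  : ∀ {κ₀ n₀ m₀ n m} →
              Ctx κ₀ n₀ m₀ command n (suc m) → Fin m → Stack n m →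
              Ctx κ₀ n₀ m₀ command n m
  _⟦∖_^_⟧ʳ  : ∀ {κ₀ n₀ m₀ n m} →
              Command n (suc m) → Fin m → Ctx κ₀ n₀ m₀ stack n m →
              Ctx κ₀ n₀ m₀ command n m
  _·ˡ_      : ∀ {κ₀ n₀ m₀ n m} →
              Ctx κ₀ n₀ m₀ term n m → Stack n m → Ctx κ₀ n₀ m₀ stack n m
  _·ʳ_      : ∀ {κ₀ n₀ m₀ n m} →
              Term n m → Ctx κ₀ n₀ m₀ stack n m → Ctx κ₀ n₀ m₀ stack n m

plug : ∀ {κ₀ n₀ m₀ κ n m} → Ctx κ₀ n₀ m₀ κ n m → Obj κ₀ n₀ m₀ → Obj κ n m
plug □                o = o
plug ⊡                o = o
plug (O ∙ˡ u)         o = plug O o ∙ u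
plug (t ∙ʳ O)         o = t ∙ plug O o
plug (ƛ O)            o = ƛ plug O o
plug (μ O)            o = μ plug O o
plug (O [∖ u ]ˡ)      o = plug O o [∖ u ]
plug (t [∖ O ]ʳ)      o = t [∖ plug O o ]
plug ([ α ] O)        o = [ α ] plug O o
plug (O ⟦∖ α′ ^ s ⟧ˡ) o = plug O o ⟦∖ α′ ^ s ⟧
plug (c ⟦∖ α′ ^ O ⟧ʳ) o = c ⟦∖ α′ ^ plug O o ⟧
plug (O ·ˡ s)         o = plug O o · s
plug (t ·ʳ O)         o = t · plug O o

-- Substitution contexts; SubCtx n₀ n m has its hole in variable scope n₀ ≥ n.
data SubCtx : (n₀ n m : ℕ) → Set where
  □      : ∀ {n m} → SubCtx n n m
  _[∖_]  : ∀ {n₀ n m} → SubCtx n₀ (suc n) m → Term n m → SubCtx n₀ n m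

plugᴸ : ∀ {n₀ n m} → SubCtx n₀ n m → Term n₀ m → Term n m
plugᴸ □          t = t
plugᴸ (L [∖ u ]) t = plugᴸ L t [∖ u ]

-- Moving an object under the binders of L, so that it is free for L.
wkᴸ : ∀ {κ n₀ n m} → SubCtx n₀ n m → Obj κ n m → Obj κ n₀ m
wkᴸ □          o = o
wkᴸ (L [∖ u ]) o = wkᴸ L (wkVar o)

infix 4 _↦_ _⟶_

data _↦_ : ∀ {κ n m} → Obj κ n m → Obj κ n m → Set where
  B : ∀ {n₀ n m} (L : SubCtx n₀ n m) (t : Term (suc n₀) m) (u : Term n m) →
      plugᴸ L (ƛ t) ∙ u ↦ plugᴸ L (t [∖ wkᴸ L u ])
  S : ∀ {n m} (t : Term (suc n) m) (u : Term n m) →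
      t [∖ u ] ↦ t ⟨ zero ∖ u ⟩
  -- On the right, the name bound by the explicit replacement is zero and the
  -- fresh α′ is zero just outside it, so lift 1 suc skips α′ in c.
  M : ∀ {n₀ n m} (L : SubCtx n₀ n m) (c : Command n₀ (suc m)) (u : Term n m) →
      plugᴸ L (μ c) ∙ u ↦
      plugᴸ L (μ (rename id (lift 1 suc) c ⟦∖ zero ^ wkName (wkᴸ L u) · ε ⟧))
  R : ∀ {n m} (c : Command n (suc m)) (α′ : Fin m) (s : Stack n m) →
      c ⟦∖ α′ ^ s ⟧ ↦ c ⟨ zero ∖ α′ ^ s ⟩

data _⟶_ {κ n m} : Obj κ n m → Obj κ n m → Set where
  close : ∀ {κ₀ n₀ m₀} (O : Ctx κ₀ n₀ m₀ κ n m) {l r : Obj κ₀ n₀ m₀} →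
          l ↦ r → plug O l ⟶ plug O r

{-# OPTIONS --safe #-}
-- Interpretation method.  Carrying out all explicit substitutions and
-- replacements maps an object o to a λμ-term nf o, written with °-constructors,
-- and o reduces to nf o.  In λμ the substitution lemma for replacement is an
-- equation, whereas in ΛM it holds only up to reduction: replacing α in
-- c ⟦∖ α ^ ε ⟧ splits stacks that a later replacement would concatenate.  A
-- ΛM-step becomes a parallel λμ-step, so the complete development of nf o serves
-- as o • in the Z-property: o ⟶ o′ implies o′ ⟶* o • ⟶* o′ •.

module Submission where

open import Defs
open import Data.Fin using (Fin; zero; suc; lift; punchOut)
open import Data.Fin.Properties using (_≟_; punchOut-cong)
open import Data.Nat using (ℕ; suc)
open import Data.Product using (_×_; _,_; proj₁; proj₂; map; map₂)
open import Function using (id; _∘_)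
open import Relation.Binary.Construct.Closure.ReflexiveTransitive
  using (Star; ε; _◅_; _◅◅_; gmap)
open import Relation.Binary.PropositionalEquality
  using (_≡_; refl; sym; trans; cong; cong₂; subst; module ≡-Reasoning)
open import Relation.Binary.Rewriting using (Confluent)
open import Relation.Nullary using (yes; no)

-- λμ-terms: syntax, stacks and renaming

infixl 8 _∙°_
infixr 7 _·°_ _++°_
infixl 7 _∷°_
infixr 6 ƛ°_ μ°_ [_]°_

-- Stacks remain a sort of their own because replacements carry them; only explicit substitution and
-- explicit replacement are dropped from `Obj`.
data Pure : Sort → ℕ → ℕ → Set where
  var°   : ∀ {n m} → Fin n → Pure term n m
  _∙°_   : ∀ {n m} → Pure term n m → Pure term n m → Pure term n m
  ƛ°_    : ∀ {n m} → Pure term (suc n) m → Pure term n m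
  μ°_    : ∀ {n m} → Pure command n (suc m) → Pure term n m
  [_]°_  : ∀ {n m} → Fin m → Pure term n m → Pure command n m
  ε°     : ∀ {n m} → Pure stack n m
  _·°_   : ∀ {n m} → Pure term n m → Pure stack n m → Pure stack n m

_++°_ : ∀ {n m} → Pure stack n m → Pure stack n m → Pure stack n m
ε°       ++° s′ = s′
(t ·° s) ++° s′ = t ·° (s ++° s′)

_∷°_ : ∀ {n m} → Pure term n m → Pure stack n m → Pure term n m
u ∷° ε°       = u
u ∷° (t ·° s) = (u ∙° t) ∷° s

++-identityʳ : ∀ {n m} (s : Pure stack n m) → s ++° ε° ≡ s
++-identityʳ ε°       = refl
++-identityʳ (t ·° s) = cong (t ·°_) (++-identityʳ s)

∷-++ : ∀ {n m} (u : Pure term n m) (s s′ : Pure stack n m) →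
       u ∷° (s ++° s′) ≡ (u ∷° s) ∷° s′
∷-++ u ε°       s′ = refl
∷-++ u (t ·° s) s′ = ∷-++ (u ∙° t) s s′

ren : ∀ {κ n n′ m m′} → (Fin n → Fin n′) → (Fin m → Fin m′) →
      Pure κ n m → Pure κ n′ m′
ren ρ ν (var° x)    = var° (ρ x)
ren ρ ν (t ∙° u)    = ren ρ ν t ∙° ren ρ ν u
ren ρ ν (ƛ° t)      = ƛ° ren (lift 1 ρ) ν t
ren ρ ν (μ° c)      = μ° ren ρ (lift 1 ν) c
ren ρ ν ([ α ]° t)  = [ ν α ]° ren ρ ν t
ren ρ ν ε°          = ε°
ren ρ ν (t ·° s)    = ren ρ ν t ·° ren ρ ν s

wkV : ∀ {κ n m} → Pure κ n m → Pure κ (suc n) m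
wkV = ren suc id

wkN : ∀ {κ n m} → Pure κ n m → Pure κ n (suc m)
wkN = ren id suc

-- Simultaneous substitution and replacement

Terms : (n n′ m′ : ℕ) → Set
Terms n n′ m′ = Fin n → Pure term n′ m′

Jump : (n m : ℕ) → Set
Jump n m = Fin m × Pure stack n m

Jumps : (m n′ m′ : ℕ) → Set
Jumps m n′ m′ = Fin m → Jump n′ m′

liftV : ∀ {n n′ m′} → Terms n n′ m′ → Terms (suc n) (suc n′) m′
liftV σ zero    = var° zero
liftV σ (suc x) = wkV (σ x)

wkVJ : ∀ {m n′ m′} → Jumps m n′ m′ → Jumps m (suc n′) m′
wkVJ τ α = map₂ wkV (τ α)

liftN : ∀ {m n′ m′} → Jumps m n′ m′ → Jumps (suc m) n′ (suc m′)
liftN τ zero    = zero , ε°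
liftN τ (suc α) = map suc wkN (τ α)

wkNT : ∀ {n n′ m′} → Terms n n′ m′ → Terms n n′ (suc m′)
wkNT σ x = wkN (σ x)

-- Simultaneous substitution and replacement: τ α = (α′ , s) replaces α by α′
-- with s appended to the arguments of every term named α.
sub : ∀ {κ n n′ m m′} → Terms n n′ m′ → Jumps m n′ m′ → Pure κ n m → Pure κ n′ m′
sub σ τ (var° x)    = σ x
sub σ τ (t ∙° u)    = sub σ τ t ∙° sub σ τ u
sub σ τ (ƛ° t)      = ƛ° sub (liftV σ) (wkVJ τ) t
sub σ τ (μ° c)      = μ° sub (wkNT σ) (liftN τ) c
sub σ τ ([ α ]° t)  = [ proj₁ (τ α) ]° (sub σ τ t ∷° proj₂ (τ α))
sub σ τ ε°          = ε°
sub σ τ (t ·° s)    = sub σ τ t ·° sub σ τ s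

jump : ∀ {m n} → Jumps m n m
jump α = α , ε°

-- Composition of a jump with a later substitution and replacement: the stack of the first jump is
-- closest to the named term, so the stack of the second is appended behind it.
subJ : ∀ {n n′ m m′} → Terms n n′ m′ → Jumps m n′ m′ → Jump n m → Jump n′ m′
subJ σ τ (α , s) = proj₁ (τ α) , sub σ τ s ++° proj₂ (τ α)

-- Composition laws of renaming and substitution

ren-++ : ∀ {n n′ m m′} (ρ : Fin n → Fin n′) (ν : Fin m → Fin m′) s s′ →
         ren ρ ν (s ++° s′) ≡ ren ρ ν s ++° ren ρ ν s′
ren-++ ρ ν ε°       s′ = refl
ren-++ ρ ν (t ·° s) s′ = cong (ren ρ ν t ·°_) (ren-++ ρ ν s s′)

ren-∷ : ∀ {n n′ m m′} (ρ : Fin n → Fin n′) (ν : Fin m → Fin m′) u s →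
        ren ρ ν (u ∷° s) ≡ ren ρ ν u ∷° ren ρ ν s
ren-∷ ρ ν u ε°       = refl
ren-∷ ρ ν u (t ·° s) = ren-∷ ρ ν (u ∙° t) s

sub-∷ : ∀ {n n′ m m′} (σ : Terms n n′ m′) (τ : Jumps m n′ m′) u s →
        sub σ τ (u ∷° s) ≡ sub σ τ u ∷° sub σ τ s
sub-∷ σ τ u ε°       = refl
sub-∷ σ τ u (t ·° s) = sub-∷ σ τ (u ∙° t) s

lift-∘ : ∀ {a b c} {f : Fin b → Fin c} {g : Fin a → Fin b} {h : Fin a → Fin c} →
         (∀ i → f (g i) ≡ h i) → ∀ i → lift 1 f (lift 1 g i) ≡ lift 1 h i
lift-∘ e zero    = refl
lift-∘ e (suc i) = cong suc (e i)

-- Start of a chain of fusion laws. To pass binders, `sub-sub` needs weakening to commute with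
-- `sub`, which rests on `sub-ren` and `ren-sub`; the latter needs the present law. Hypotheses are
-- pointwise, so functions never have to be equal.
ren-ren : ∀ {κ n₁ n₂ n₃ m₁ m₂ m₃}
          {ρ₂ : Fin n₂ → Fin n₃} {ν₂ : Fin m₂ → Fin m₃}
          {ρ₁ : Fin n₁ → Fin n₂} {ν₁ : Fin m₁ → Fin m₂}
          {ρ : Fin n₁ → Fin n₃} {ν : Fin m₁ → Fin m₃} →
          (∀ x → ρ₂ (ρ₁ x) ≡ ρ x) → (∀ α → ν₂ (ν₁ α) ≡ ν α) →
          (t : Pure κ n₁ m₁) → ren ρ₂ ν₂ (ren ρ₁ ν₁ t) ≡ ren ρ ν t
ren-ren e f (var° x)    = cong var° (e x)
ren-ren e f (t ∙° u)    = cong₂ _∙°_ (ren-ren e f t) (ren-ren e f u)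
ren-ren e f (ƛ° t)      = cong ƛ°_ (ren-ren (lift-∘ e) f t)
ren-ren e f (μ° c)      = cong μ°_ (ren-ren e (lift-∘ f) c)
ren-ren e f ([ α ]° t)  = cong₂ [_]°_ (f α) (ren-ren e f t)
ren-ren e f ε°          = refl
ren-ren e f (t ·° s)    = cong₂ _·°_ (ren-ren e f t) (ren-ren e f s)

ren-wkV : ∀ {κ n n′ m m′} (ρ : Fin n → Fin n′) (ν : Fin m → Fin m′) (t : Pure κ n m) →
          ren (lift 1 ρ) ν (wkV t) ≡ wkV (ren ρ ν t)
ren-wkV ρ ν t = trans (ren-ren (λ _ → refl) (λ _ → refl) t)
                      (sym (ren-ren (λ _ → refl) (λ _ → refl) t))

ren-wkN : ∀ {κ n n′ m m′} (ρ : Fin n → Fin n′) (ν : Fin m → Fin m′) (t : Pure κ n m) →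
          ren ρ (lift 1 ν) (wkN t) ≡ wkN (ren ρ ν t)
ren-wkN ρ ν t = trans (ren-ren (λ _ → refl) (λ _ → refl) t)
                      (sym (ren-ren (λ _ → refl) (λ _ → refl) t))

sub-ren : ∀ {κ n₁ n₂ n₃ m₁ m₂ m₃}
          {σ₂ : Terms n₂ n₃ m₃} {τ₂ : Jumps m₂ n₃ m₃}
          {ρ₁ : Fin n₁ → Fin n₂} {ν₁ : Fin m₁ → Fin m₂}
          {σ : Terms n₁ n₃ m₃} {τ : Jumps m₁ n₃ m₃} →
          (∀ x → σ₂ (ρ₁ x) ≡ σ x) → (∀ α → τ₂ (ν₁ α) ≡ τ α) →
          (t : Pure κ n₁ m₁) → sub σ₂ τ₂ (ren ρ₁ ν₁ t) ≡ sub σ τ t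
sub-ren e f (var° x)    = e x
sub-ren e f (t ∙° u)    = cong₂ _∙°_ (sub-ren e f t) (sub-ren e f u)
sub-ren e f (ƛ° t)      = cong ƛ°_ (sub-ren
  (λ { zero → refl ; (suc x) → cong wkV (e x) })
  (λ α → cong (map₂ wkV) (f α)) t)
sub-ren e f (μ° c)      = cong μ°_ (sub-ren
  (λ x → cong wkN (e x))
  (λ { zero → refl ; (suc α) → cong (map suc wkN) (f α) }) c)
sub-ren e f ([ α ]° t)  =
  cong₂ (λ j u → [ proj₁ j ]° (u ∷° proj₂ j)) (f α) (sub-ren e f t)
sub-ren e f ε°          = refl
sub-ren e f (t ·° s)    = cong₂ _·°_ (sub-ren e f t) (sub-ren e f s)

ren-sub : ∀ {κ n₁ n₂ n₃ m₁ m₂ m₃}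
          {ρ₂ : Fin n₂ → Fin n₃} {ν₂ : Fin m₂ → Fin m₃}
          {σ₁ : Terms n₁ n₂ m₂} {τ₁ : Jumps m₁ n₂ m₂}
          {σ : Terms n₁ n₃ m₃} {τ : Jumps m₁ n₃ m₃} →
          (∀ x → ren ρ₂ ν₂ (σ₁ x) ≡ σ x) →
          (∀ α → map ν₂ (ren ρ₂ ν₂) (τ₁ α) ≡ τ α) →
          (t : Pure κ n₁ m₁) → ren ρ₂ ν₂ (sub σ₁ τ₁ t) ≡ sub σ τ t
ren-sub e f (var° x)    = e x
ren-sub e f (t ∙° u)    = cong₂ _∙°_ (ren-sub e f t) (ren-sub e f u)
ren-sub e f (ƛ° t)      = cong ƛ°_ (ren-sub
  (λ { zero → refl ; (suc x) → trans (ren-wkV _ _ _) (cong wkV (e x)) })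
  (λ α → trans (cong (_ ,_) (ren-wkV _ _ _)) (cong (map₂ wkV) (f α))) t)
ren-sub e f (μ° c)      = cong μ°_ (ren-sub
  (λ x → trans (ren-wkN _ _ _) (cong wkN (e x)))
  (λ { zero → refl
     ; (suc α) → trans (cong (_ ,_) (ren-wkN _ _ _)) (cong (map suc wkN) (f α)) }) c)
ren-sub {ρ₂ = ρ₂} {ν₂} {σ₁} {τ₁} e f ([ α ]° t) = cong₂ [_]°_ (cong proj₁ (f α))
  (trans (ren-∷ ρ₂ ν₂ (sub σ₁ τ₁ t) (proj₂ (τ₁ α))) (cong₂ _∷°_ (ren-sub e f t) (cong proj₂ (f α))))
ren-sub e f ε°          = refl
ren-sub e f (t ·° s)    = cong₂ _·°_ (ren-sub e f t) (ren-sub e f s)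

sub-wkV : ∀ {κ n n′ m m′} (σ : Terms n n′ m′) (τ : Jumps m n′ m′) (t : Pure κ n m) →
          sub (liftV σ) (wkVJ τ) (wkV t) ≡ wkV (sub σ τ t)
sub-wkV σ τ t = trans (sub-ren (λ _ → refl) (λ _ → refl) t)
                      (sym (ren-sub (λ _ → refl) (λ _ → refl) t))

sub-wkN : ∀ {κ n n′ m m′} (σ : Terms n n′ m′) (τ : Jumps m n′ m′) (t : Pure κ n m) →
          sub (wkNT σ) (liftN τ) (wkN t) ≡ wkN (sub σ τ t)
sub-wkN σ τ t = trans (sub-ren (λ _ → refl) (λ _ → refl) t)
                      (sym (ren-sub (λ _ → refl) (λ _ → refl) t))

subJ-wkV : ∀ {n n′ m m′} (σ : Terms n n′ m′) (τ : Jumps m n′ m′) (j : Jump n m) →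
           subJ (liftV σ) (wkVJ τ) (map₂ wkV j) ≡ map₂ wkV (subJ σ τ j)
subJ-wkV σ τ (α , s) = cong (_ ,_)
  (trans (cong (_++° _) (sub-wkV σ τ s)) (sym (ren-++ _ _ (sub σ τ s) _)))

subJ-wkN : ∀ {n n′ m m′} (σ : Terms n n′ m′) (τ : Jumps m n′ m′) (j : Jump n m) →
           subJ (wkNT σ) (liftN τ) (map suc wkN j) ≡ map suc wkN (subJ σ τ j)
subJ-wkN σ τ (α , s) = cong (_ ,_)
  (trans (cong (_++° _) (sub-wkN σ τ s)) (sym (ren-++ _ _ (sub σ τ s) _)))

sub-sub : ∀ {κ n₁ n₂ n₃ m₁ m₂ m₃}
          {σ₂ : Terms n₂ n₃ m₃} {τ₂ : Jumps m₂ n₃ m₃}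
          {σ₁ : Terms n₁ n₂ m₂} {τ₁ : Jumps m₁ n₂ m₂}
          {σ : Terms n₁ n₃ m₃} {τ : Jumps m₁ n₃ m₃} →
          (∀ x → sub σ₂ τ₂ (σ₁ x) ≡ σ x) → (∀ α → subJ σ₂ τ₂ (τ₁ α) ≡ τ α) →
          (t : Pure κ n₁ m₁) → sub σ₂ τ₂ (sub σ₁ τ₁ t) ≡ sub σ τ t
sub-sub e f (var° x)    = e x
sub-sub e f (t ∙° u)    = cong₂ _∙°_ (sub-sub e f t) (sub-sub e f u)
sub-sub {σ₂ = σ₂} {τ₂} {σ₁} {τ₁} e f (ƛ° t) = cong ƛ°_ (sub-sub
  (λ { zero → refl ; (suc x) → trans (sub-wkV σ₂ τ₂ (σ₁ x)) (cong wkV (e x)) })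
  (λ α → trans (subJ-wkV σ₂ τ₂ (τ₁ α)) (cong (map₂ wkV) (f α))) t)
sub-sub {σ₂ = σ₂} {τ₂} {σ₁} {τ₁} e f (μ° c) = cong μ°_ (sub-sub
  (λ x → trans (sub-wkN σ₂ τ₂ (σ₁ x)) (cong wkN (e x)))
  (λ { zero → refl
     ; (suc α) → trans (subJ-wkN σ₂ τ₂ (τ₁ α)) (cong (map suc wkN) (f α)) }) c)
sub-sub {σ₂ = σ₂} {τ₂} {σ₁} {τ₁} {σ} {τ} e f ([ α ]° t) =
  cong₂ [_]°_ (cong proj₁ (f α)) (begin
    sub σ₂ τ₂ (sub σ₁ τ₁ t ∷° s) ∷° s′         ≡⟨ cong (_∷° s′) (sub-∷ σ₂ τ₂ (sub σ₁ τ₁ t) s) ⟩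
    -- The two stacks appended in succession merge into one concatenated stack, which is exactly the
    -- second component of `subJ`.
    (sub σ₂ τ₂ (sub σ₁ τ₁ t) ∷° sub σ₂ τ₂ s) ∷° s′  ≡⟨ sym (∷-++ _ (sub σ₂ τ₂ s) s′) ⟩
    sub σ₂ τ₂ (sub σ₁ τ₁ t) ∷° (sub σ₂ τ₂ s ++° s′)
      ≡⟨ cong₂ _∷°_ (sub-sub e f t) (cong proj₂ (f α)) ⟩
    sub σ τ t ∷° proj₂ (τ α)                   ∎)
  where
  open ≡-Reasoning
  s  = proj₂ (τ₁ α)
  s′ = proj₂ (τ₂ (proj₁ (τ₁ α)))
sub-sub e f ε°          = refl
sub-sub e f (t ·° s)    = cong₂ _·°_ (sub-sub e f t) (sub-sub e f s)

sub-id : ∀ {κ n m} {σ : Terms n n m} {τ : Jumps m n m} →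
         (∀ x → σ x ≡ var° x) → (∀ α → τ α ≡ jump α) →
         (t : Pure κ n m) → sub σ τ t ≡ t
sub-id e f (var° x)    = e x
sub-id e f (t ∙° u)    = cong₂ _∙°_ (sub-id e f t) (sub-id e f u)
sub-id e f (ƛ° t)      = cong ƛ°_ (sub-id
  (λ { zero → refl ; (suc x) → cong wkV (e x) })
  (λ α → cong (map₂ wkV) (f α)) t)
sub-id e f (μ° c)      = cong μ°_ (sub-id
  (λ x → cong wkN (e x))
  (λ { zero → refl ; (suc α) → cong (map suc wkN) (f α) }) c)
sub-id e f ([ α ]° t)  =
  cong₂ (λ j u → [ proj₁ j ]° (u ∷° proj₂ j)) (f α) (sub-id e f t)
sub-id e f ε°          = refl
sub-id e f (t ·° s)    = cong₂ _·°_ (sub-id e f t) (sub-id e f s)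

subJ-id : ∀ {n m} {σ : Terms n n m} {τ : Jumps m n m} →
          (∀ x → σ x ≡ var° x) → (∀ α → τ α ≡ jump α) →
          (j : Jump n m) → subJ σ τ j ≡ j
subJ-id e f (α , s) = cong₂ _,_ (cong proj₁ (f α))
  (trans (cong₂ _++°_ (sub-id e f s) (cong proj₂ (f α))) (++-identityʳ s))

-- Follows from `sub-sub` without a new induction: composing with the identity substitution on the
-- outside leaves the term unchanged and turns the composite into any pointwise equal one.
sub-cong : ∀ {κ n n′ m m′} {σ σ′ : Terms n n′ m′} {τ τ′ : Jumps m n′ m′} →
           (∀ x → σ x ≡ σ′ x) → (∀ α → τ α ≡ τ′ α) →
           (t : Pure κ n m) → sub σ τ t ≡ sub σ′ τ′ t
sub-cong e f t = trans (sym (sub-id (λ _ → refl) (λ _ → refl) (sub _ _ t)))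
  (sub-sub (λ x → trans (sub-id (λ _ → refl) (λ _ → refl) _) (e x))
           (λ α → trans (subJ-id (λ _ → refl) (λ _ → refl) _) (f α)) t)

sub-comm : ∀ {κ n₁ n₂ n₃ n₄ m₁ m₂ m₃ m₄}
           {σ₂ : Terms n₂ n₄ m₄} {τ₂ : Jumps m₂ n₄ m₄}
           {σ₁ : Terms n₁ n₂ m₂} {τ₁ : Jumps m₁ n₂ m₂}
           {σ₄ : Terms n₃ n₄ m₄} {τ₄ : Jumps m₃ n₄ m₄}
           {σ₃ : Terms n₁ n₃ m₃} {τ₃ : Jumps m₁ n₃ m₃} →
           (∀ x → sub σ₂ τ₂ (σ₁ x) ≡ sub σ₄ τ₄ (σ₃ x)) →
           (∀ α → subJ σ₂ τ₂ (τ₁ α) ≡ subJ σ₄ τ₄ (τ₃ α)) →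
           (t : Pure κ n₁ m₁) →
           sub σ₂ τ₂ (sub σ₁ τ₁ t) ≡ sub σ₄ τ₄ (sub σ₃ τ₃ t)
sub-comm e f t = trans (sub-sub e f t) (sym (sub-sub (λ _ → refl) (λ _ → refl) t))

-- Single substitution, single replacement and the action of a μ-redex

single : ∀ {n m} → Fin (suc n) → Pure term n m → Terms (suc n) n m
single x u y with x ≟ y
... | yes _   = u
... | no  x≢y = var° (punchOut x≢y)

repl : ∀ {n m} → Fin (suc m) → Jump n m → Jumps (suc m) n m
repl α j β with α ≟ β
... | yes _   = j
... | no  α≢β = jump (punchOut α≢β)

-- The effect of a μ-redex with argument u; its fresh name reuses index zero.
feed : ∀ {n m} → Pure term n m → Jumps (suc m) n (suc m)
feed u zero    = zero , wkN u ·° ε°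
feed u (suc α) = jump (suc α)

-- This and the next three laws reconcile two ways of entering a binder: `sub` lifts the whole
-- substitution, while the operations on `Obj` shift the eliminated index and weaken the argument.
single-liftV : ∀ {κ n m} (x : Fin (suc n)) (u : Pure term n m) (t : Pure κ (suc (suc n)) m) →
               sub (liftV (single x u)) (wkVJ jump) t ≡ sub (single (suc x) (wkV u)) jump t
single-liftV x u = sub-cong e (λ _ → refl)
  where
  e : ∀ y → liftV (single x u) y ≡ single (suc x) (wkV u) y
  e zero = refl
  e (suc y) with x ≟ y
  ... | yes _ = refl
  -- The two calls of `punchOut` receive different proofs of the same inequality, and
  -- `punchOut-cong` makes this harmless.
  ... | no  _ = cong (var° ∘ suc) (punchOut-cong x refl)

single-wkNT : ∀ {κ n m} (x : Fin (suc n)) (u : Pure term n m) (t : Pure κ (suc n) (suc m)) →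
              sub (wkNT (single x u)) (liftN jump) t ≡ sub (single x (wkN u)) jump t
single-wkNT x u = sub-cong e λ { zero → refl ; (suc _) → refl }
  where
  e : ∀ y → wkNT (single x u) y ≡ single x (wkN u) y
  e y with x ≟ y
  ... | yes _ = refl
  ... | no  _ = refl

repl-wkVJ : ∀ {κ n m} (α : Fin (suc m)) (j : Jump n m) (t : Pure κ (suc n) (suc m)) →
            sub (liftV var°) (wkVJ (repl α j)) t ≡ sub var° (repl α (map₂ wkV j)) t
repl-wkVJ α j = sub-cong (λ { zero → refl ; (suc _) → refl }) e
  where
  e : ∀ β → wkVJ (repl α j) β ≡ repl α (map₂ wkV j) β
  e β with α ≟ β
  ... | yes _ = refl
  ... | no  _ = refl

repl-liftN : ∀ {κ n m} (α : Fin (suc m)) (j : Jump n m) (t : Pure κ n (suc (suc m))) →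
             sub (wkNT var°) (liftN (repl α j)) t ≡ sub var° (repl (suc α) (map suc wkN j)) t
repl-liftN α j = sub-cong (λ _ → refl) e
  where
  e : ∀ β → liftN (repl α j) β ≡ repl (suc α) (map suc wkN j) β
  e zero = refl
  e (suc β) with α ≟ β
  ... | yes _ = refl
  ... | no  _ = cong (jump ∘ suc) (punchOut-cong α refl)

-- Links rule `M` with `feed`: the renaming makes room for the fresh name, and carrying out the
-- replacement eliminates the old bound name, so the scope is again the original one.
repl-lift-suc : ∀ {κ n m} (u : Pure term n m) (t : Pure κ n (suc m)) →
                sub var° (repl zero (zero , wkN u ·° ε°)) (ren id (lift 1 suc) t) ≡
                sub var° (feed u) t
repl-lift-suc u = sub-ren (λ _ → refl) λ { zero → refl ; (suc _) → refl }

ren-as-sub : ∀ {κ n n′ m m′} (ρ : Fin n → Fin n′) (ν : Fin m → Fin m′) (t : Pure κ n m) →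
             ren ρ ν t ≡ sub (var° ∘ ρ) (jump ∘ ν) t
ren-as-sub ρ ν t = trans (sym (sub-id (λ _ → refl) (λ _ → refl) (ren ρ ν t)))
                         (sub-ren (λ _ → refl) (λ _ → refl) t)

single-wkV : ∀ {κ n m} (u : Pure term n m) (t : Pure κ n m) →
             sub (single zero u) jump (wkV t) ≡ t
single-wkV u t = trans (sub-ren (λ _ → refl) (λ _ → refl) t)
                       (sub-id (λ _ → refl) (λ _ → refl) t)

repl-wkN : ∀ {κ n m} (j : Jump n m) (t : Pure κ n m) →
           sub var° (repl zero j) (wkN t) ≡ t
repl-wkN j t = trans (sub-ren (λ _ → refl) (λ _ → refl) t)
                     (sub-id (λ _ → refl) (λ _ → refl) t)

feed-wkN : ∀ {κ n m} (u : Pure term n m) (t : Pure κ n m) →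
           sub var° (feed u) (wkN t) ≡ wkN t
feed-wkN u t = trans (sub-ren (λ _ → refl) (λ _ → refl) t) (sym (ren-as-sub id suc t))

ren-single : ∀ {κ n n′ m m′} (ρ : Fin n → Fin n′) (ν : Fin m → Fin m′) u
             (t : Pure κ (suc n) m) →
             sub (single zero (ren ρ ν u)) jump (ren (lift 1 ρ) ν t) ≡
             ren ρ ν (sub (single zero u) jump t)
ren-single ρ ν u t =
  trans (sub-ren (λ { zero → refl ; (suc _) → refl }) (λ _ → refl) t)
        (sym (ren-sub (λ _ → refl) (λ _ → refl) t))

ren-repl : ∀ {κ n n′ m m′} (ρ : Fin n → Fin n′) (ν : Fin m → Fin m′) j
           (t : Pure κ n (suc m)) →
           sub var° (repl zero (map ν (ren ρ ν) j)) (ren ρ (lift 1 ν) t) ≡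
           ren ρ ν (sub var° (repl zero j) t)
ren-repl ρ ν j t =
  trans (sub-ren (λ _ → refl) (λ { zero → refl ; (suc _) → refl }) t)
        (sym (ren-sub (λ _ → refl) (λ _ → refl) t))

ren-feed : ∀ {κ n n′ m m′} (ρ : Fin n → Fin n′) (ν : Fin m → Fin m′) u
           (t : Pure κ n (suc m)) →
           sub var° (feed (ren ρ ν u)) (ren ρ (lift 1 ν) t) ≡
           ren ρ (lift 1 ν) (sub var° (feed u) t)
ren-feed ρ ν u t =
  trans (sub-ren (λ _ → refl)
          (λ { zero → cong (λ v → zero , v ·° ε°) (sym (ren-wkN ρ ν u))
             ; (suc _) → refl }) t)
        (sym (ren-sub (λ _ → refl) (λ _ → refl) t))

sub-single : ∀ {κ n n′ m m′} (σ : Terms n n′ m′) (τ : Jumps m n′ m′) u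
             (t : Pure κ (suc n) m) →
             sub (single zero (sub σ τ u)) jump (sub (liftV σ) (wkVJ τ) t) ≡
             sub σ τ (sub (single zero u) jump t)
sub-single σ τ u = sub-comm
  (λ { zero → refl ; (suc x) → single-wkV _ (σ x) })
  (λ α → cong (_ ,_) (trans (++-identityʳ _) (single-wkV _ _)))

-- An equation even if `τ` replaces the target of `j`, since `subJ` concatenates the two stacks, be
-- they empty or not.
sub-repl : ∀ {κ n n′ m m′} (σ : Terms n n′ m′) (τ : Jumps m n′ m′) j
           (t : Pure κ n (suc m)) →
           sub var° (repl zero (subJ σ τ j)) (sub (wkNT σ) (liftN τ) t) ≡
           sub σ τ (sub var° (repl zero j) t)
sub-repl σ τ j = sub-comm
  (λ x → repl-wkN _ (σ x))
  (λ { zero → refl ; (suc α) → cong (_ ,_) (trans (++-identityʳ _) (repl-wkN _ _)) })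

-- The contractum of a μ-redex binds its name again, so the substitution stays lifted on both sides.
-- It fixes the bound name, hence commutes with the pushing of the argument.
sub-feed : ∀ {κ n n′ m m′} (σ : Terms n n′ m′) (τ : Jumps m n′ m′) u
           (t : Pure κ n (suc m)) →
           sub var° (feed (sub σ τ u)) (sub (wkNT σ) (liftN τ) t) ≡
           sub (wkNT σ) (liftN τ) (sub var° (feed u) t)
sub-feed σ τ u = sub-comm
  (λ x → feed-wkN _ (σ x))
  (λ { zero → cong (λ v → zero , v ·° ε°) (sym (sub-wkN σ τ u))
     ; (suc α) → cong (_ ,_) (trans (++-identityʳ _) (feed-wkN _ _)) })

-- Interpretation of ΛM-objects as λμ-terms

nf : ∀ {κ n m} → Obj κ n m → Pure κ n m
nf (var x)         = var° x
nf (t ∙ u)         = nf t ∙° nf u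
nf (ƛ t)           = ƛ° nf t
nf (μ c)           = μ° nf c
nf (t [∖ u ])      = sub (single zero (nf u)) jump (nf t)
nf ([ α ] t)       = [ α ]° nf t
nf (c ⟦∖ α ^ s ⟧)  = sub var° (repl zero (α , nf s)) (nf c)
nf ε               = ε°
nf (t · s)         = nf t ·° nf s

nf-++ : ∀ {n m} (s s′ : Stack n m) → nf (s ++ s′) ≡ nf s ++° nf s′
nf-++ ε       s′ = refl
nf-++ (t · s) s′ = cong (nf t ·°_) (nf-++ s s′)

nf-∷ : ∀ {n m} (u : Term n m) (s : Stack n m) → nf (u ∷ s) ≡ nf u ∷° nf s
nf-∷ u ε       = refl
nf-∷ u (t · s) = nf-∷ (u ∙ t) s

nf-rename : ∀ {κ n n′ m m′} (ρ : Fin n → Fin n′) (ν : Fin m → Fin m′) (o : Obj κ n m) →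
            nf (rename ρ ν o) ≡ ren ρ ν (nf o)
nf-rename ρ ν (var x)         = refl
nf-rename ρ ν (t ∙ u)         = cong₂ _∙°_ (nf-rename ρ ν t) (nf-rename ρ ν u)
nf-rename ρ ν (ƛ t)           = cong ƛ°_ (nf-rename (lift 1 ρ) ν t)
nf-rename ρ ν (μ c)           = cong μ°_ (nf-rename ρ (lift 1 ν) c)
nf-rename ρ ν (t [∖ u ])      = trans
  (cong₂ (λ v → sub (single zero v) jump) (nf-rename ρ ν u) (nf-rename (lift 1 ρ) ν t))
  (ren-single ρ ν (nf u) (nf t))
nf-rename ρ ν ([ α ] t)       = cong ([ ν α ]°_) (nf-rename ρ ν t)
nf-rename ρ ν (c ⟦∖ α ^ s ⟧)  = trans
  (cong₂ (λ s′ → sub var° (repl zero (ν α , s′))) (nf-rename ρ ν s) (nf-rename ρ (lift 1 ν) c))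
  (ren-repl ρ ν (α , nf s) (nf c))
nf-rename ρ ν ε               = refl
nf-rename ρ ν (t · s)         = cong₂ _·°_ (nf-rename ρ ν t) (nf-rename ρ ν s)

nf-subst : ∀ {κ n m} (o : Obj κ (suc n) m) (x : Fin (suc n)) (u : Term n m) →
           nf (o ⟨ x ∖ u ⟩) ≡ sub (single x (nf u)) jump (nf o)

-- The induction hypothesis of `nf-subst` in the form required under a variable binder, with the
-- lifted substitution.
nf-subst-wkVar : ∀ {κ n m} (o : Obj κ (suc (suc n)) m) (x : Fin (suc n)) (u : Term n m) →
                 nf (o ⟨ suc x ∖ wkVar u ⟩) ≡ sub (liftV (single x (nf u))) (wkVJ jump) (nf o)
nf-subst-wkVar o x u = trans (nf-subst o (suc x) (wkVar u)) (trans
  (cong (λ v → sub (single (suc x) v) jump (nf o)) (nf-rename suc id u))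
  (sym (single-liftV x (nf u) (nf o))))

nf-subst-wkName : ∀ {κ n m} (o : Obj κ (suc n) (suc m)) (x : Fin (suc n)) (u : Term n m) →
                  nf (o ⟨ x ∖ wkName u ⟩) ≡ sub (wkNT (single x (nf u))) (liftN jump) (nf o)
nf-subst-wkName o x u = trans (nf-subst o x (wkName u)) (trans
  (cong (λ v → sub (single x v) jump (nf o)) (nf-rename id suc u))
  (sym (single-wkNT x (nf u) (nf o))))

nf-subst (var y) x u with x ≟ y
... | yes _ = refl
... | no  _ = refl
nf-subst (t ∙ v) x u         = cong₂ _∙°_ (nf-subst t x u) (nf-subst v x u)
nf-subst (ƛ t) x u           = cong ƛ°_ (nf-subst-wkVar t x u)
nf-subst (μ c) x u           = cong μ°_ (nf-subst-wkName c x u)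
nf-subst (t [∖ v ]) x u      = trans
  (cong₂ (λ w → sub (single zero w) jump) (nf-subst v x u) (nf-subst-wkVar t x u))
  (sub-single (single x (nf u)) jump (nf v) (nf t))
nf-subst ([ α ] t) x u       = cong ([ α ]°_) (nf-subst t x u)
nf-subst (c ⟦∖ α ^ s ⟧) x u  = trans
  (cong₂ (λ s′ → sub var° (repl zero (α , s′)))
    -- `subJ` appends the stack of `jump α`, which is empty.
    (trans (nf-subst s x u) (sym (++-identityʳ _))) (nf-subst-wkName c x u))
  (sub-repl (single x (nf u)) jump (α , nf s) (nf c))
nf-subst ε x u               = refl
nf-subst (t · s) x u         = cong₂ _·°_ (nf-subst t x u) (nf-subst s x u)

-- Splitting a replacement through a fresh name is invisible to `nf`: carrying out both halves has
-- the effect of one replacement with the concatenated stack.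
nf-extend : ∀ {n m} (c : Command n (suc m)) (α : Fin m) (s′ s : Stack n m) →
            nf (extend c α s′ s) ≡ sub var° (repl zero (α , nf s′ ++° nf s)) (nf c)
nf-extend c α ε        ε         = refl
nf-extend c α ε        s@(_ · _) = trans
  (cong₂ (λ s″ → sub var° (repl zero (α , ε°)) ∘ sub var° (repl zero (zero , s″)))
    (nf-rename id suc s) (nf-rename id (lift 1 suc) c))
  (trans
    (cong (sub var° (repl zero (α , ε°)))
      (sub-ren (λ _ → refl) (λ { zero → refl ; (suc _) → refl }) (nf c)))
    -- `τ₁` is the inner replacement fused with the renaming: the bound name goes to the fresh name
    -- `zero`, which the outer replacement then sends to `α`.
    (sub-sub {τ₁ = λ { zero → zero , wkN (nf s) ; (suc β) → jump (suc β) }} (λ _ → refl)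
      (λ { zero → cong (α ,_) (trans (++-identityʳ _) (repl-wkN _ (nf s)))
         ; (suc _) → refl }) (nf c)))
nf-extend c α s′@(_ · _) s       =
  cong (λ s″ → sub var° (repl zero (α , s″)) (nf c)) (nf-++ s′ s)

nf-replace : ∀ {κ n m} (o : Obj κ n (suc m)) (α : Fin (suc m)) (α′ : Fin m) (s : Stack n m) →
             nf (o ⟨ α ∖ α′ ^ s ⟩) ≡ sub var° (repl α (α′ , nf s)) (nf o)

nf-replace-wkVar : ∀ {κ n m} (o : Obj κ (suc n) (suc m)) (α : Fin (suc m)) (α′ : Fin m)
                   (s : Stack n m) →
                   nf (o ⟨ α ∖ α′ ^ wkVar s ⟩) ≡
                   sub (liftV var°) (wkVJ (repl α (α′ , nf s))) (nf o)
nf-replace-wkVar o α α′ s = trans (nf-replace o α α′ (wkVar s)) (trans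
  (cong (λ s′ → sub var° (repl α (α′ , s′)) (nf o)) (nf-rename suc id s))
  (sym (repl-wkVJ α (α′ , nf s) (nf o))))

nf-replace-wkName : ∀ {κ n m} (o : Obj κ n (suc (suc m))) (α : Fin (suc m)) (α′ : Fin m)
                    (s : Stack n m) →
                    nf (o ⟨ suc α ∖ suc α′ ^ wkName s ⟩) ≡
                    sub (wkNT var°) (liftN (repl α (α′ , nf s))) (nf o)
nf-replace-wkName o α α′ s = trans (nf-replace o (suc α) (suc α′) (wkName s)) (trans
  (cong (λ s′ → sub var° (repl (suc α) (suc α′ , s′)) (nf o)) (nf-rename id suc s))
  (sym (repl-liftN α (α′ , nf s) (nf o))))

nf-replace (var x) α α′ s      = refl
nf-replace (t ∙ u) α α′ s      = cong₂ _∙°_ (nf-replace t α α′ s) (nf-replace u α α′ s)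
nf-replace (ƛ t) α α′ s        = cong ƛ°_ (nf-replace-wkVar t α α′ s)
nf-replace (μ c) α α′ s        = cong μ°_ (nf-replace-wkName c α α′ s)
nf-replace (t [∖ u ]) α α′ s   = trans
  (cong₂ (λ v → sub (single zero v) jump) (nf-replace u α α′ s) (nf-replace-wkVar t α α′ s))
  (sub-single var° (repl α (α′ , nf s)) (nf u) (nf t))
nf-replace ([ β ] t) α α′ s with α ≟ β
... | yes _   = cong ([ α′ ]°_)
                  (trans (nf-∷ (t ⟨ α ∖ α′ ^ s ⟩) s) (cong (_∷° nf s) (nf-replace t α α′ s)))
... | no  α≢β = cong ([ punchOut α≢β ]°_) (nf-replace t α α′ s)
nf-replace (c ⟦∖ β ^ s′ ⟧) α α′ s =
  -- The test `α ≟ β` occurs on both sides, in the replacement on objects and inside `subJ`; `step`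
  -- decides it once for both.
  trans step (sub-repl var° (repl α (α′ , nf s)) (β , nf s′) (nf c))
  where
  step : nf ((c ⟦∖ β ^ s′ ⟧) ⟨ α ∖ α′ ^ s ⟩) ≡
         sub var° (repl zero (subJ var° (repl α (α′ , nf s)) (β , nf s′)))
                  (sub (wkNT var°) (liftN (repl α (α′ , nf s))) (nf c))
  step with α ≟ β
  ... | yes _   = trans
    (nf-extend (c ⟨ suc α ∖ suc α′ ^ wkName s ⟩) α′ (s′ ⟨ α ∖ α′ ^ s ⟩) s)
    (cong₂ (λ s″ → sub var° (repl zero (α′ , s″ ++° nf s)))
      (nf-replace s′ α α′ s) (nf-replace-wkName c α α′ s))
  ... | no  α≢β = cong₂ (λ s″ → sub var° (repl zero (punchOut α≢β , s″)))
    (trans (nf-replace s′ α α′ s) (sym (++-identityʳ _))) (nf-replace-wkName c α α′ s)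
nf-replace ε α α′ s            = refl
nf-replace (t · s′) α α′ s     = cong₂ _·°_ (nf-replace t α α′ s) (nf-replace s′ α α′ s)

-- Embedding of λμ-terms into ΛM

⌜_⌝ : ∀ {κ n m} → Pure κ n m → Obj κ n m
⌜ var° x ⌝     = var x
⌜ t ∙° u ⌝     = ⌜ t ⌝ ∙ ⌜ u ⌝
⌜ ƛ° t ⌝       = ƛ ⌜ t ⌝
⌜ μ° c ⌝       = μ ⌜ c ⌝
⌜ [ α ]° t ⌝   = [ α ] ⌜ t ⌝
⌜ ε° ⌝         = ε
⌜ t ·° s ⌝     = ⌜ t ⌝ · ⌜ s ⌝

⌜⌝-∷ : ∀ {n m} (u : Pure term n m) (s : Pure stack n m) → ⌜ u ∷° s ⌝ ≡ ⌜ u ⌝ ∷ ⌜ s ⌝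
⌜⌝-∷ u ε°       = refl
⌜⌝-∷ u (t ·° s) = ⌜⌝-∷ (u ∙° t) s

⌜⌝-ren : ∀ {κ n n′ m m′} (ρ : Fin n → Fin n′) (ν : Fin m → Fin m′) (t : Pure κ n m) →
         ⌜ ren ρ ν t ⌝ ≡ rename ρ ν ⌜ t ⌝
⌜⌝-ren ρ ν (var° x)    = refl
⌜⌝-ren ρ ν (t ∙° u)    = cong₂ _∙_ (⌜⌝-ren ρ ν t) (⌜⌝-ren ρ ν u)
⌜⌝-ren ρ ν (ƛ° t)      = cong ƛ_ (⌜⌝-ren (lift 1 ρ) ν t)
⌜⌝-ren ρ ν (μ° c)      = cong μ_ (⌜⌝-ren ρ (lift 1 ν) c)
⌜⌝-ren ρ ν ([ α ]° t)  = cong ([ ν α ]_) (⌜⌝-ren ρ ν t)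
⌜⌝-ren ρ ν ε°          = refl
⌜⌝-ren ρ ν (t ·° s)    = cong₂ _·_ (⌜⌝-ren ρ ν t) (⌜⌝-ren ρ ν s)

⌜⌝-single : ∀ {κ n m} (x : Fin (suc n)) (u : Pure term n m) (t : Pure κ (suc n) m) →
            ⌜ sub (single x u) jump t ⌝ ≡ ⌜ t ⌝ ⟨ x ∖ ⌜ u ⌝ ⟩
⌜⌝-single x u (var° y) with x ≟ y
... | yes _ = refl
... | no  _ = refl
⌜⌝-single x u (t ∙° v)    = cong₂ _∙_ (⌜⌝-single x u t) (⌜⌝-single x u v)
⌜⌝-single x u (ƛ° t)      = cong ƛ_ (trans (cong ⌜_⌝ (single-liftV x u t))
  (trans (⌜⌝-single (suc x) (wkV u) t) (cong (⌜ t ⌝ ⟨ suc x ∖_⟩) (⌜⌝-ren suc id u))))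
⌜⌝-single x u (μ° c)      = cong μ_ (trans (cong ⌜_⌝ (single-wkNT x u c))
  (trans (⌜⌝-single x (wkN u) c) (cong (⌜ c ⌝ ⟨ x ∖_⟩) (⌜⌝-ren id suc u))))
⌜⌝-single x u ([ α ]° t)  = cong ([ α ]_) (⌜⌝-single x u t)
⌜⌝-single x u ε°          = refl
⌜⌝-single x u (t ·° s)    = cong₂ _·_ (⌜⌝-single x u t) (⌜⌝-single x u s)

-- An embedded term has no explicit replacement, so the splitting done by `extend` never arises and
-- both replacements agree constructor by constructor.
⌜⌝-repl : ∀ {κ n m} (α : Fin (suc m)) (α′ : Fin m) (s : Pure stack n m)
          (t : Pure κ n (suc m)) →
          ⌜ sub var° (repl α (α′ , s)) t ⌝ ≡ ⌜ t ⌝ ⟨ α ∖ α′ ^ ⌜ s ⌝ ⟩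
⌜⌝-repl α α′ s (var° x)    = refl
⌜⌝-repl α α′ s (t ∙° u)    = cong₂ _∙_ (⌜⌝-repl α α′ s t) (⌜⌝-repl α α′ s u)
⌜⌝-repl α α′ s (ƛ° t)      = cong ƛ_ (trans (cong ⌜_⌝ (repl-wkVJ α (α′ , s) t))
  (trans (⌜⌝-repl α α′ (wkV s) t) (cong (⌜ t ⌝ ⟨ α ∖ α′ ^_⟩) (⌜⌝-ren suc id s))))
⌜⌝-repl α α′ s (μ° c)      = cong μ_ (trans (cong ⌜_⌝ (repl-liftN α (α′ , s) c))
  (trans (⌜⌝-repl (suc α) (suc α′) (wkN s) c)
    (cong (⌜ c ⌝ ⟨ suc α ∖ suc α′ ^_⟩) (⌜⌝-ren id suc s))))
⌜⌝-repl α α′ s ([ β ]° t) with α ≟ β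
... | yes _   = cong ([ α′ ]_)
                  (trans (⌜⌝-∷ (sub var° _ t) s) (cong (_∷ ⌜ s ⌝) (⌜⌝-repl α α′ s t)))
... | no  α≢β = cong ([ punchOut α≢β ]_) (⌜⌝-repl α α′ s t)
⌜⌝-repl α α′ s ε°          = refl
⌜⌝-repl α α′ s (t ·° s′)   = cong₂ _·_ (⌜⌝-repl α α′ s t) (⌜⌝-repl α α′ s s′)

-- Parallel λμ-reduction

infix 4 _⇛_ _⇛ᴶ_ _⟶*_

-- A μ-redex absorbs one argument per step and remains a `μ°`, as in rule `M`, but the replacement
-- is carried out at once.
data _⇛_ : ∀ {κ n m} → Pure κ n m → Pure κ n m → Set where
  var°   : ∀ {n m} (x : Fin n) → var° {m = m} x ⇛ var° x
  _∙°_   : ∀ {n m} {t t′ u u′ : Pure term n m} → t ⇛ t′ → u ⇛ u′ → t ∙° u ⇛ t′ ∙° u′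
  ƛ°_    : ∀ {n m} {t t′ : Pure term (suc n) m} → t ⇛ t′ → ƛ° t ⇛ ƛ° t′
  μ°_    : ∀ {n m} {c c′ : Pure command n (suc m)} → c ⇛ c′ → μ° c ⇛ μ° c′
  [_]°_  : ∀ {n m} (α : Fin m) {t t′ : Pure term n m} → t ⇛ t′ → [ α ]° t ⇛ [ α ]° t′
  ε°     : ∀ {n m} → ε° {n} {m} ⇛ ε°
  _·°_   : ∀ {n m} {t t′ : Pure term n m} {s s′ : Pure stack n m} →
           t ⇛ t′ → s ⇛ s′ → t ·° s ⇛ t′ ·° s′
  ƛβ     : ∀ {n m} {t t′ : Pure term (suc n) m} {u u′ : Pure term n m} →
           t ⇛ t′ → u ⇛ u′ → (ƛ° t) ∙° u ⇛ sub (single zero u′) jump t′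
  μβ     : ∀ {n m} {c c′ : Pure command n (suc m)} {u u′ : Pure term n m} →
           c ⇛ c′ → u ⇛ u′ → (μ° c) ∙° u ⇛ μ° sub var° (feed u′) c′

⇛-respʳ-≡ : ∀ {κ n m} {t u v : Pure κ n m} → u ≡ v → t ⇛ u → t ⇛ v
⇛-respʳ-≡ refl p = p

⇛-refl : ∀ {κ n m} (t : Pure κ n m) → t ⇛ t
⇛-refl (var° x)    = var° x
⇛-refl (t ∙° u)    = ⇛-refl t ∙° ⇛-refl u
⇛-refl (ƛ° t)      = ƛ° ⇛-refl t
⇛-refl (μ° c)      = μ° ⇛-refl c
⇛-refl ([ α ]° t)  = [ α ]° ⇛-refl t
⇛-refl ε°          = ε°
⇛-refl (t ·° s)    = ⇛-refl t ·° ⇛-refl s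

⇛-∷ : ∀ {n m} {u u′ : Pure term n m} {s s′ : Pure stack n m} →
      u ⇛ u′ → s ⇛ s′ → u ∷° s ⇛ u′ ∷° s′
⇛-∷ p ε°       = p
⇛-∷ p (q ·° r) = ⇛-∷ (p ∙° q) r

⇛-ren : ∀ {κ n n′ m m′} (ρ : Fin n → Fin n′) (ν : Fin m → Fin m′) {t t′ : Pure κ n m} →
        t ⇛ t′ → ren ρ ν t ⇛ ren ρ ν t′
⇛-ren ρ ν (var° x)    = var° (ρ x)
⇛-ren ρ ν (p ∙° q)    = ⇛-ren ρ ν p ∙° ⇛-ren ρ ν q
⇛-ren ρ ν (ƛ° p)      = ƛ° ⇛-ren (lift 1 ρ) ν p
⇛-ren ρ ν (μ° p)      = μ° ⇛-ren ρ (lift 1 ν) p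
⇛-ren ρ ν ([ α ]° p)  = [ ν α ]° ⇛-ren ρ ν p
⇛-ren ρ ν ε°          = ε°
⇛-ren ρ ν (p ·° q)    = ⇛-ren ρ ν p ·° ⇛-ren ρ ν q
⇛-ren ρ ν (ƛβ {t′ = t′} {u′ = u′} p q) =
  ⇛-respʳ-≡ (ren-single ρ ν u′ t′) (ƛβ (⇛-ren (lift 1 ρ) ν p) (⇛-ren ρ ν q))
⇛-ren ρ ν (μβ {c′ = c′} {u′ = u′} p q) =
  ⇛-respʳ-≡ (cong μ°_ (ren-feed ρ ν u′ c′)) (μβ (⇛-ren ρ (lift 1 ν) p) (⇛-ren ρ ν q))

_⇛ᴶ_ : ∀ {n m} → Jump n m → Jump n m → Set
(α , s) ⇛ᴶ (α′ , s′) = α ≡ α′ × s ⇛ s′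

-- The redex cases rely on the substitution equations `sub-single` and `sub-feed`: contracting the
-- substituted redex must give the substituted contractum itself.
⇛-sub : ∀ {κ n n′ m m′} {σ σ′ : Terms n n′ m′} {τ τ′ : Jumps m n′ m′} →
        (∀ x → σ x ⇛ σ′ x) → (∀ α → τ α ⇛ᴶ τ′ α) →
        {t t′ : Pure κ n m} → t ⇛ t′ → sub σ τ t ⇛ sub σ′ τ′ t′

⇛-sub-ƛ : ∀ {κ n n′ m m′} {σ σ′ : Terms n n′ m′} {τ τ′ : Jumps m n′ m′} →
          (∀ x → σ x ⇛ σ′ x) → (∀ α → τ α ⇛ᴶ τ′ α) →
          {t t′ : Pure κ (suc n) m} → t ⇛ t′ →
          sub (liftV σ) (wkVJ τ) t ⇛ sub (liftV σ′) (wkVJ τ′) t′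
⇛-sub-ƛ p q = ⇛-sub (λ { zero → var° zero ; (suc x) → ⇛-ren suc id (p x) })
                    (λ α → map₂ (⇛-ren suc id) (q α))

⇛-sub-μ : ∀ {κ n n′ m m′} {σ σ′ : Terms n n′ m′} {τ τ′ : Jumps m n′ m′} →
          (∀ x → σ x ⇛ σ′ x) → (∀ α → τ α ⇛ᴶ τ′ α) →
          {t t′ : Pure κ n (suc m)} → t ⇛ t′ →
          sub (wkNT σ) (liftN τ) t ⇛ sub (wkNT σ′) (liftN τ′) t′
⇛-sub-μ p q = ⇛-sub (λ x → ⇛-ren id suc (p x))
                    (λ { zero → refl , ε° ; (suc α) → map (cong suc) (⇛-ren id suc) (q α) })

⇛-sub p q (var° x)    = p x
⇛-sub p q (r ∙° r′)   = ⇛-sub p q r ∙° ⇛-sub p q r′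
⇛-sub p q (ƛ° r)      = ƛ° ⇛-sub-ƛ p q r
⇛-sub p q (μ° r)      = μ° ⇛-sub-μ p q r
⇛-sub p q ([ α ]° r)  = subst (λ γ → _ ⇛ [ γ ]° _) (proj₁ (q α))
                          ([ _ ]° ⇛-∷ (⇛-sub p q r) (proj₂ (q α)))
⇛-sub p q ε°          = ε°
⇛-sub p q (r ·° r′)   = ⇛-sub p q r ·° ⇛-sub p q r′
⇛-sub p q (ƛβ {t′ = t′} {u′ = u′} r r′) =
  ⇛-respʳ-≡ (sub-single _ _ u′ t′) (ƛβ (⇛-sub-ƛ p q r) (⇛-sub p q r′))
⇛-sub p q (μβ {c′ = c′} {u′ = u′} r r′) =
  ⇛-respʳ-≡ (cong μ°_ (sub-feed _ _ u′ c′)) (μβ (⇛-sub-μ p q r) (⇛-sub p q r′))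

⇛-single : ∀ {κ n m} {u u′ : Pure term n m} {t t′ : Pure κ (suc n) m} →
           u ⇛ u′ → t ⇛ t′ → sub (single zero u) jump t ⇛ sub (single zero u′) jump t′
⇛-single p = ⇛-sub (λ { zero → p ; (suc x) → var° x }) (λ _ → refl , ε°)

⇛-repl : ∀ {κ n m} (α : Fin m) {s s′ : Pure stack n m} {t t′ : Pure κ n (suc m)} →
         s ⇛ s′ → t ⇛ t′ → sub var° (repl zero (α , s)) t ⇛ sub var° (repl zero (α , s′)) t′
⇛-repl α p = ⇛-sub var° (λ { zero → refl , p ; (suc _) → refl , ε° })

⇛-feed : ∀ {κ n m} {u u′ : Pure term n m} {t t′ : Pure κ n (suc m)} →
         u ⇛ u′ → t ⇛ t′ → sub var° (feed u) t ⇛ sub var° (feed u′) t′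
⇛-feed p = ⇛-sub var° (λ { zero → refl , (⇛-ren id suc p ·° ε°) ; (suc _) → refl , ε° })

-- Complete development and the triangle property

develop : ∀ {κ n m} → Pure κ n m → Pure κ n m
develop (var° x)       = var° x
develop ((ƛ° t) ∙° u)  = sub (single zero (develop u)) jump (develop t)
develop ((μ° c) ∙° u)  = μ° sub var° (feed (develop u)) (develop c)
develop (t ∙° u)       = develop t ∙° develop u
develop (ƛ° t)         = ƛ° develop t
develop (μ° c)         = μ° develop c
develop ([ α ]° t)     = [ α ]° develop t
develop ε°             = ε°
develop (t ·° s)       = develop t ·° develop s

-- Redexes of the source left alone by the step are still redexes and get contracted now; for those
-- already contracted, the induction hypotheses combine by `⇛-single` and `⇛-feed`.
triangle : ∀ {κ n m} {t t′ : Pure κ n m} → t ⇛ t′ → t′ ⇛ develop t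
triangle (var° x)             = var° x
triangle (var° x ∙° q)        = var° x ∙° triangle q
-- In this and the next two clauses the function part of the source is an application. Hence the
-- source is no redex at its root, and a root redex created by `p` is not contracted.
triangle (p@(_ ∙° _) ∙° q)    = triangle p ∙° triangle q
triangle (p@(ƛβ _ _) ∙° q)    = triangle p ∙° triangle q
triangle (p@(μβ _ _) ∙° q)    = triangle p ∙° triangle q
triangle ((ƛ° p) ∙° q)        = ƛβ (triangle p) (triangle q)
triangle ((μ° p) ∙° q)        = μβ (triangle p) (triangle q)
triangle (ƛ° p)               = ƛ° triangle p
triangle (μ° p)               = μ° triangle p
triangle ([ α ]° p)           = [ α ]° triangle p
triangle ε°                   = ε°
triangle (p ·° q)             = triangle p ·° triangle q
triangle (ƛβ p q)             = ⇛-single (triangle q) (triangle p)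
triangle (μβ p q)             = μ° ⇛-feed (triangle q) (triangle p)

-- Simulation of ΛM-steps by parallel steps

-- Removes the distance from rules `B` and `M`: `nf` carries out the substitutions of `L`, and these
-- have no effect on the argument, which is weakened under the binders of `L`.
nf-plugᴸ-∙ : ∀ {n₀ n m} (L : SubCtx n₀ n m) {t t′ : Term n₀ m} {u : Term n m} →
             nf (t ∙ wkᴸ L u) ⇛ nf t′ → nf (plugᴸ L t ∙ u) ⇛ nf (plugᴸ L t′)
nf-plugᴸ-∙ □          p = p
nf-plugᴸ-∙ (L [∖ w ]) {t} {t′} {u} p =
  subst (λ v → sub (single zero (nf w)) jump (nf (plugᴸ L t)) ∙° v ⇛ _)
    (trans (cong (sub (single zero (nf w)) jump) (nf-rename suc id u)) (single-wkV (nf w) (nf u)))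
    (⇛-single (⇛-refl (nf w)) (nf-plugᴸ-∙ L p))

-- Rules `S` and `R` leave the normal form unchanged; only `B` and `M` contract a λμ-redex.
nf-↦ : ∀ {κ n m} {l r : Obj κ n m} → l ↦ r → nf l ⇛ nf r
nf-↦ (B L t u)    = nf-plugᴸ-∙ L {ƛ t} {t [∖ wkᴸ L u ]} {u}
                      (ƛβ (⇛-refl (nf t)) (⇛-refl (nf (wkᴸ L u))))
nf-↦ (S t u)      = ⇛-respʳ-≡ (sym (nf-subst t zero u)) (⇛-refl _)
nf-↦ (M L c u)    = nf-plugᴸ-∙ L {μ c} {_} {u} (⇛-respʳ-≡ (cong μ°_ (sym eq))
                      (μβ (⇛-refl (nf c)) (⇛-refl (nf (wkᴸ L u)))))
  where
  eq : nf (rename id (lift 1 suc) c ⟦∖ zero ^ wkName (wkᴸ L u) · ε ⟧) ≡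
       sub var° (feed (nf (wkᴸ L u))) (nf c)
  eq = trans (cong₂ (λ v → sub var° (repl zero (zero , v ·° ε°)))
               (nf-rename id suc (wkᴸ L u)) (nf-rename id (lift 1 suc) c))
             (repl-lift-suc (nf (wkᴸ L u)) (nf c))
nf-↦ (R c α s)    = ⇛-respʳ-≡ (sym (nf-replace c zero α s)) (⇛-refl _)

-- Parallel steps are essential here: a redex inside an explicit substitution or replacement may be
-- copied or erased by `nf`.
nf-plug : ∀ {κ₀ n₀ m₀ κ n m} (O : Ctx κ₀ n₀ m₀ κ n m) {l r : Obj κ₀ n₀ m₀} →
          nf l ⇛ nf r → nf (plug O l) ⇛ nf (plug O r)
nf-plug □                p = p
nf-plug ⊡                p = p
nf-plug (O ∙ˡ u)         p = nf-plug O p ∙° ⇛-refl (nf u)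
nf-plug (t ∙ʳ O)         p = ⇛-refl (nf t) ∙° nf-plug O p
nf-plug (ƛ O)            p = ƛ° nf-plug O p
nf-plug (μ O)            p = μ° nf-plug O p
nf-plug (O [∖ u ]ˡ)      p = ⇛-single (⇛-refl (nf u)) (nf-plug O p)
nf-plug (t [∖ O ]ʳ)      p = ⇛-single (nf-plug O p) (⇛-refl (nf t))
nf-plug ([ α ] O)        p = [ α ]° nf-plug O p
nf-plug (O ⟦∖ α ^ s ⟧ˡ)  p = ⇛-repl α (⇛-refl (nf s)) (nf-plug O p)
nf-plug (c ⟦∖ α ^ O ⟧ʳ)  p = ⇛-repl α (nf-plug O p) (⇛-refl (nf c))
nf-plug (O ·ˡ s)         p = nf-plug O p ·° ⇛-refl (nf s)
nf-plug (t ·ʳ O)         p = ⇛-refl (nf t) ·° nf-plug O p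

nf-⟶ : ∀ {κ n m} {o o′ : Obj κ n m} → o ⟶ o′ → nf o ⇛ nf o′
nf-⟶ (close O r) = nf-plug O (nf-↦ r)

-- ΛM-reductions to normal forms and along parallel steps

_⟶*_ : ∀ {κ n m} → Obj κ n m → Obj κ n m → Set
_⟶*_ = Star _⟶_

reflexive : ∀ {κ n m} {o o′ : Obj κ n m} → o ≡ o′ → o ⟶* o′
reflexive refl = ε

∙-⟶* : ∀ {n m} {t t′ u u′ : Term n m} → t ⟶* t′ → u ⟶* u′ → t ∙ u ⟶* t′ ∙ u′
∙-⟶* p q = gmap (_∙ _) (λ { (close O r) → close (O ∙ˡ _) r }) p
        ◅◅ gmap (_ ∙_) (λ { (close O r) → close (_ ∙ʳ O) r }) q

ƛ-⟶* : ∀ {n m} {t t′ : Term (suc n) m} → t ⟶* t′ → ƛ t ⟶* ƛ t′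
ƛ-⟶* = gmap ƛ_ λ { (close O r) → close (ƛ O) r }

μ-⟶* : ∀ {n m} {c c′ : Command n (suc m)} → c ⟶* c′ → μ c ⟶* μ c′
μ-⟶* = gmap μ_ λ { (close O r) → close (μ O) r }

[∖]-⟶* : ∀ {n m} {t t′ : Term (suc n) m} {u u′ : Term n m} →
         t ⟶* t′ → u ⟶* u′ → t [∖ u ] ⟶* t′ [∖ u′ ]
[∖]-⟶* p q = gmap _[∖ _ ] (λ { (close O r) → close (O [∖ _ ]ˡ) r }) p
          ◅◅ gmap (_ [∖_]) (λ { (close O r) → close (_ [∖ O ]ʳ) r }) q

[]-⟶* : ∀ {n m} (α : Fin m) {t t′ : Term n m} → t ⟶* t′ → [ α ] t ⟶* [ α ] t′
[]-⟶* α = gmap ([ α ]_) λ { (close O r) → close ([ α ] O) r }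

⟦∖⟧-⟶* : ∀ {n m} {c c′ : Command n (suc m)} (α : Fin m) {s s′ : Stack n m} →
         c ⟶* c′ → s ⟶* s′ → c ⟦∖ α ^ s ⟧ ⟶* c′ ⟦∖ α ^ s′ ⟧
⟦∖⟧-⟶* α p q = gmap _⟦∖ α ^ _ ⟧ (λ { (close O r) → close (O ⟦∖ α ^ _ ⟧ˡ) r }) p
            ◅◅ gmap (_ ⟦∖ α ^_⟧) (λ { (close O r) → close (_ ⟦∖ α ^ O ⟧ʳ) r }) q

·-⟶* : ∀ {n m} {t t′ : Term n m} {s s′ : Stack n m} →
       t ⟶* t′ → s ⟶* s′ → t · s ⟶* t′ · s′
·-⟶* p q = gmap (_· _) (λ { (close O r) → close (O ·ˡ _) r }) p
        ◅◅ gmap (_ ·_) (λ { (close O r) → close (_ ·ʳ O) r }) q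

S-⟶* : ∀ {n m} (t : Pure term (suc n) m) (u : Pure term n m) →
       ⌜ t ⌝ [∖ ⌜ u ⌝ ] ⟶* ⌜ sub (single zero u) jump t ⌝
S-⟶* t u = close □ (S ⌜ t ⌝ ⌜ u ⌝) ◅ reflexive (sym (⌜⌝-single zero u t))

R-⟶* : ∀ {n m} (c : Pure command n (suc m)) (α : Fin m) (s : Pure stack n m) →
       ⌜ c ⌝ ⟦∖ α ^ ⌜ s ⌝ ⟧ ⟶* ⌜ sub var° (repl zero (α , s)) c ⌝
R-⟶* c α s = close ⊡ (R ⌜ c ⌝ α ⌜ s ⌝) ◅ reflexive (sym (⌜⌝-repl zero α s c))

feed-⟶* : ∀ {n m} (c : Pure command n (suc m)) (u : Pure term n m) →
          rename id (lift 1 suc) ⌜ c ⌝ ⟦∖ zero ^ wkName ⌜ u ⌝ · ε ⟧ ⟶*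
          ⌜ sub var° (feed u) c ⌝
feed-⟶* c u =
  reflexive (cong₂ (λ c′ v → c′ ⟦∖ zero ^ v · ε ⟧)
    (sym (⌜⌝-ren id (lift 1 suc) c)) (sym (⌜⌝-ren id suc u)))
  ◅◅ R-⟶* (ren id (lift 1 suc) c) zero (wkN u ·° ε°)
  ◅◅ reflexive (cong ⌜_⌝ (repl-lift-suc u c))

⟶*-nf : ∀ {κ n m} (o : Obj κ n m) → o ⟶* ⌜ nf o ⌝
⟶*-nf (var x)         = ε
⟶*-nf (t ∙ u)         = ∙-⟶* (⟶*-nf t) (⟶*-nf u)
⟶*-nf (ƛ t)           = ƛ-⟶* (⟶*-nf t)
⟶*-nf (μ c)           = μ-⟶* (⟶*-nf c)
⟶*-nf (t [∖ u ])      = [∖]-⟶* (⟶*-nf t) (⟶*-nf u) ◅◅ S-⟶* (nf t) (nf u)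
⟶*-nf ([ α ] t)       = []-⟶* α (⟶*-nf t)
⟶*-nf (c ⟦∖ α ^ s ⟧)  = ⟦∖⟧-⟶* α (⟶*-nf c) (⟶*-nf s) ◅◅ R-⟶* (nf c) α (nf s)
⟶*-nf ε               = ε
⟶*-nf (t · s)         = ·-⟶* (⟶*-nf t) (⟶*-nf s)

-- Each contraction is `B` followed by `S`, or `M` followed by `R`. The empty substitution context
-- suffices, as embedded terms contain no explicit substitution.
⇛-⟶* : ∀ {κ n m} {t t′ : Pure κ n m} → t ⇛ t′ → ⌜ t ⌝ ⟶* ⌜ t′ ⌝
⇛-⟶* (var° x)    = ε
⇛-⟶* (p ∙° q)    = ∙-⟶* (⇛-⟶* p) (⇛-⟶* q)
⇛-⟶* (ƛ° p)      = ƛ-⟶* (⇛-⟶* p)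
⇛-⟶* (μ° p)      = μ-⟶* (⇛-⟶* p)
⇛-⟶* ([ α ]° p)  = []-⟶* α (⇛-⟶* p)
⇛-⟶* ε°          = ε
⇛-⟶* (p ·° q)    = ·-⟶* (⇛-⟶* p) (⇛-⟶* q)
⇛-⟶* (ƛβ {t′ = t} {u′ = u} p q) = ∙-⟶* (ƛ-⟶* (⇛-⟶* p)) (⇛-⟶* q)
  ◅◅ close □ (B □ ⌜ t ⌝ ⌜ u ⌝) ◅ S-⟶* t u
⇛-⟶* (μβ {c′ = c} {u′ = u} p q) = ∙-⟶* (μ-⟶* (⇛-⟶* p)) (⇛-⟶* q)
  ◅◅ close □ (M □ ⌜ c ⌝ ⌜ u ⌝) ◅ μ-⟶* (feed-⟶* c u)

-- The Z-property and confluence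

_• : ∀ {κ n m} → Obj κ n m → Obj κ n m
o • = ⌜ develop (nf o) ⌝

⟶*-• : ∀ {κ n m} (o : Obj κ n m) → o ⟶* o •
⟶*-• o = ⟶*-nf o ◅◅ ⇛-⟶* (triangle (⇛-refl (nf o)))

•-upper : ∀ {κ n m} {o o′ : Obj κ n m} → o ⟶ o′ → o′ ⟶* o •
•-upper {o′ = o′} r = ⟶*-nf o′ ◅◅ ⇛-⟶* (triangle (nf-⟶ r))

•-mono : ∀ {κ n m} {o o′ : Obj κ n m} → o ⟶* o′ → o • ⟶* o′ •
•-mono ε        = ε
-- The inner `triangle` leads from the normal form of the reduct to the development of the source;
-- applying `triangle` to that step relates the two developments.
•-mono (r ◅ rs) = ⇛-⟶* (triangle (triangle (nf-⟶ r))) ◅◅ •-mono rs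

-- Induction on the first reduction. After its first step the object reduces to the development of
-- the common source, and by monotonicity on to `C •`. The induction hypothesis joins this with the
-- rest of the first reduction, and `C` itself reduces to `C •`.
theorem5 : ∀ (κ : Sort) (n m : ℕ) → Confluent (_⟶_ {κ} {n} {m})
theorem5 κ n m ε        qs = _ , qs , ε
theorem5 κ n m {C = C} (p ◅ ps) qs with theorem5 κ n m ps (•-upper p ◅◅ •-mono qs)
... | o , rs , rs′ = o , rs , ⟶*-• C ◅◅ rs′
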